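{- Let $(A,\gamma)$ be a partially ordered set. If $\mathrm{hsdim}(A,\gamma)=1$, then $\gamma$ is a half-space, and $\dim(A,\gamma)=1$ if $\gamma$ is a linear order while $\dim(A,\gamma)=2$ if $\gamma$ is not a linear order. If $\mathrm{hsdim}(A,\gamma)\ge2$, then $\dim(A,\gamma)=\mathrm{hsdim}(A,\gamma)$.
   Context: A quasiorder on $A$ is a reflexive and transitive relation; $\Delta_A=\{(a,a)\mid a\in A\}$. A quasiorder $\alpha$ on $A$ is a half-space if there is a quasiorder $\beta$ on $A$ with $\alpha\cup\beta=A\times A$ and $\alpha\cap\beta=\Delta_A$. A half-space realizer of a quasiorder $\gamma$ on $A$ is a set $\{\alpha_i\mid i\in I\}$ of half-spaces on $A$ with $\bigcap_{i\in I}\alpha_i=\gamma$; $\mathrm{hsdim}(A,\gamma)$ is the minimum cardinality of a half-space realizer. $\dim(A,\gamma)$ is the order dimension: the least cardinality of a set of linear extensions of $\gamma$ whose intersection is $\gamma$. -}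

module Defs where

open import Data.Fin.Base using (Fin)
open import Data.Nat.Base using (ℕ)
open import Data.Product.Base using (Σ-syntax; _×_)
open import Function.Bundles using (_↣_)
open import Level using (Level; suc; _⊔_; Lift)
open import Relation.Binary.Construct.Intersection using (_∩_)
open import Relation.Binary.Construct.Union using (_∪_)
open import Relation.Binary.Core using (Rel; _⇒_; _⇔_)
open import Relation.Binary.Definitions using (Universal)
open import Relation.Binary.PropositionalEquality.Core using (_≡_)
open import Relation.Binary.Structures using (IsPreorder; IsTotalOrder)

private
  variable
    ℓ p : Level

IsQuasiorder : {A : Set ℓ} → Rel A ℓ → Set ℓ
IsQuasiorder α = IsPreorder _≡_ α

IsLinearOrder : {A : Set ℓ} → Rel A ℓ → Set ℓ
IsLinearOrder α = IsTotalOrder _≡_ α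

IsHalfSpace : {A : Set ℓ} → Rel A ℓ → Set (suc ℓ)
IsHalfSpace {ℓ = ℓ} {A = A} α =
  IsQuasiorder α ×
  (Σ[ β ∈ Rel A ℓ ] (IsQuasiorder β × Universal (α ∪ β) × (α ∩ β) ⇔ _≡_))

IsLinearExtension : {A : Set ℓ} → Rel A ℓ → Rel A ℓ → Set ℓ
IsLinearExtension γ α = IsLinearOrder α × (γ ⇒ α)

-- A set of cardinality I of relations satisfying P, with intersection γ.
-- The set is enumerated without repetition up to extensional equality, so
-- that its cardinality is that of the index type I.  I may be empty, in
-- which case the intersection is A × A.
record Realizer {A : Set ℓ} (P : Rel A ℓ → Set p) (γ : Rel A ℓ) (I : Set ℓ)
                : Set (suc ℓ ⊔ p) where
  field
    rel          : I → Rel A ℓ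
    distinct     : ∀ {i j} → rel i ⇔ rel j → i ≡ j
    member       : ∀ i → P (rel i)
    intersection : (λ x y → ∀ i → rel i x y) ⇔ γ

-- Cardinals are represented by types, and |I| ≤ |J| by I ↣ J.
IsMinCardinality : (Set ℓ → Set p) → Set ℓ → Set (suc ℓ ⊔ p)
IsMinCardinality {ℓ = ℓ} R κ = R κ × (∀ (J : Set ℓ) → R J → κ ↣ J)

infix 4 hsdim_≡ᶜ_ dim_≡ᶜ_

hsdim_≡ᶜ_ : {A : Set ℓ} → Rel A ℓ → Set ℓ → Set (suc ℓ)
hsdim γ ≡ᶜ κ = IsMinCardinality (Realizer IsHalfSpace γ) κ

dim_≡ᶜ_ : {A : Set ℓ} → Rel A ℓ → Set ℓ → Set (suc ℓ)
dim γ ≡ᶜ κ = IsMinCardinality (Realizer (IsLinearExtension γ) γ) κ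

card : ℕ → Set ℓ
card {ℓ = ℓ} n = Lift ℓ (Fin n)

{-# OPTIONS --safe #-}

-- If α is a half-space then α and its complement (plus the diagonal) are both
-- transitive, so A is a linear sum of blocks on each of which α is either full or
-- an antichain.  A half-space containing γ therefore becomes a linear extension of
-- γ once every full block is ordered by a fixed linear extension L of γ and every
-- antichain block by an arbitrary linear order.  Given a half-space realizer (αᵢ)
-- with at least two indices 0 ≠ 1, order the antichain blocks of α₀ opposite to a
-- refinement of α₁, and those of all other αᵢ opposite to the resulting
-- refinement of α₀: every pair that is incomparable in some αᵢ is then reversed
-- between two members, so the refinements form a realizer of γ.  Coincidences among
-- them are removed by choosing representatives, and minimality of the half-space
-- dimension with Cantor–Schröder–Bernstein restores the index set.  Conversely
-- linear orders are half-spaces.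
--
-- L is obtained without Zorn's lemma: the subsets of A generated from ∅ by adjoining
-- a chosen new element and by unions form a well-ordered chain, which gives a
-- lexicographic linear order on all subsets of A; compare points by their γ-downsets.
module Submission where

open import Defs
open import Axiom.ExcludedMiddle using (ExcludedMiddle)
open import Axiom.Extensionality.Propositional using (Extensionality; lower-extensionality)
open import Axiom.UniquenessOfIdentityProofs using (module Decidable⇒UIP)
open import Data.Bool.Base using (Bool; true; false; T)
open import Data.Bool.Properties using (T?)
open import Data.Empty using (⊥-elim)
open import Data.Fin.Base using (zero) renaming (suc to fsuc)
open import Data.Maybe.Base using (Maybe; just; nothing)
open import Data.Maybe.Properties using (just-injective)
open import Data.Product.Base using (Σ-syntax; ∃-syntax; _×_; _,_; proj₁; proj₂)
open import Data.Product.Properties using (Σ-≡,≡→≡)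
open import Data.Sum.Base using (_⊎_; inj₁; inj₂)
open import Function.Base using (_∘_; flip; const)
open import Function.Bundles using (_↣_; Injection; mk↣)
open import Function.Definitions using (Injective)
open import Level using (Level; suc; 0ℓ; Lift; lift; lower)
open import Relation.Binary.Core using (Rel; _⇒_; _⇔_)
open import Relation.Binary.PropositionalEquality.Core using (_≡_; _≢_; refl; sym; trans; cong; subst)
open import Relation.Binary.PropositionalEquality.Properties using (isEquivalence)
open import Relation.Binary.Structures using (IsPartialOrder; IsPreorder; IsTotalOrder)
open import Relation.Nullary.Decidable.Core using (Dec; yes; no; ⌊_⌋; toWitness; fromWitness; map′; decidable-stable)
open import Relation.Nullary.Negation.Core using (¬_; contradiction)

private
  variable
    ℓ p : Level

lower-em : ExcludedMiddle (suc ℓ) → ExcludedMiddle ℓ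
lower-em {ℓ} em = map′ lower lift (em {Lift (suc ℓ) _})

-- Half-spaces and linear orders

module _ {A : Set ℓ} where

  quasiorder-resp-⇔ : {α β : Rel A ℓ} → α ⇔ β → IsQuasiorder α → IsQuasiorder β
  quasiorder-resp-⇔ (to , from) q = record
    { isEquivalence = isEquivalence
    ; reflexive     = to ∘ q.reflexive
    ; trans         = λ x≤y y≤z → to (q.trans (from x≤y) (from y≤z))
    }
    where module q = IsPreorder q

  halfSpace-resp-⇔ : {α β : Rel A ℓ} → α ⇔ β → IsHalfSpace α → IsHalfSpace β
  halfSpace-resp-⇔ {α} {β} α⇔β@(to , from) (qα , α′ , qα′ , total , meet) =
    quasiorder-resp-⇔ {α} {β} α⇔β qα , α′ , qα′ , total′ ,
    (λ (p , q) → proj₁ meet (from p , q)) ,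
    (λ x≡y → to (proj₁ (proj₂ meet x≡y)) , proj₂ (proj₂ meet x≡y))
    where
    total′ : ∀ x y → β x y ⊎ α′ x y
    total′ x y with total x y
    ... | inj₁ p = inj₁ (to p)
    ... | inj₂ q = inj₂ q

  linear-resp-⇔ : {α β : Rel A ℓ} → α ⇔ β → IsLinearOrder α → IsLinearOrder β
  linear-resp-⇔ {α} {β} α⇔β@(to , from) lin = record
    { isPartialOrder = record
      { isPreorder = quasiorder-resp-⇔ {α} {β} α⇔β l.isPreorder
      ; antisym    = λ p q → l.antisym (from p) (from q)
      }
    ; total = total′
    }
    where
    module l = IsTotalOrder lin
    total′ : ∀ x y → β x y ⊎ β y x
    total′ x y with l.total x y
    ... | inj₁ p = inj₁ (to p)
    ... | inj₂ q = inj₂ (to q)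

  flip-linear : {α : Rel A ℓ} → IsLinearOrder α → IsLinearOrder (flip α)
  flip-linear lin = record
    { isPartialOrder = record
      { isPreorder = record
        { isEquivalence = isEquivalence
        ; reflexive     = λ { refl → l.refl }
        ; trans         = flip l.trans
        }
      ; antisym = flip l.antisym
      }
    ; total = flip l.total
    }
    where module l = IsTotalOrder lin

  linear⇒halfSpace : {α : Rel A ℓ} → IsLinearOrder α → IsHalfSpace α
  linear⇒halfSpace {α} lin =
    l.isPreorder , flip α , IsTotalOrder.isPreorder (flip-linear lin) , l.total ,
    (λ (p , q) → l.antisym p q) , λ { refl → l.refl , l.refl }
    where module l = IsTotalOrder lin

  linearRealizer⇒halfSpaceRealizer : {γ : Rel A ℓ} {J : Set ℓ} →
    Realizer (IsLinearExtension γ) γ J → Realizer IsHalfSpace γ J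
  linearRealizer⇒halfSpaceRealizer R = record
    { rel          = rel
    ; distinct     = distinct
    ; member       = linear⇒halfSpace ∘ proj₁ ∘ member
    ; intersection = intersection
    }
    where open Realizer R

  -- A least member coincides with the intersection. For a `γ` that is not linear this excludes
  -- realizers whose members all agree.
  least-linear : {γ : Rel A ℓ} {I : Set ℓ} (ρ : I → Rel A ℓ) →
    (λ x y → ∀ i → ρ i x y) ⇔ γ →
    ∀ {j} → IsLinearOrder (ρ j) → (∀ i {x y} → ρ j x y → ρ i x y) → IsLinearOrder γ
  least-linear {γ} ρ (⋂⇒γ , γ⇒⋂) {j} lin least = linear-resp-⇔ {α = ρ j} {β = γ}
    ((λ ρjxy → ⋂⇒γ λ i → least i ρjxy) , λ γxy → γ⇒⋂ γxy j) lin

-- Towers of subsets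

-- Values in `Bool` keep subsets and families of subsets at level `ℓ`, so that `⋃` can quantify over
-- them without raising the level.
Subset : Set ℓ → Set ℓ
Subset A = A → Bool

module _ {A : Set ℓ} where

  infix 4 _∈_ _∉_ _⊆_

  _∈_ _∉_ : A → Subset A → Set
  a ∈ S = T (S a)
  a ∉ S = ¬ a ∈ S

  _⊆_ : Rel (Subset A) ℓ
  S ⊆ S′ = ∀ a → a ∈ S → a ∈ S′

  Agree : Subset A → Subset A → Subset A → Set ℓ
  Agree U V S = ∀ a → a ∈ S → U a ≡ V a

T-injective : ∀ {b c} → (T b → T c) → (T c → T b) → b ≡ c
T-injective {false} {false} _ _ = refl
T-injective {false} {true}  _ g = ⊥-elim (g _)
T-injective {true}  {false} f _ = ⊥-elim (f _)
T-injective {true}  {true}  _ _ = refl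

module Classical (em : ExcludedMiddle ℓ) (ext : Extensionality ℓ 0ℓ) where

  ⟦_⟧ : {A : Set ℓ} → (A → Set ℓ) → Subset A
  ⟦ P ⟧ a = ⌊ em {P a} ⌋

  ∈⟦⟧⁺ : {P : Set ℓ} → P → T ⌊ em {P} ⌋
  ∈⟦⟧⁺ = fromWitness

  ∈⟦⟧⁻ : {P : Set ℓ} → T ⌊ em {P} ⌋ → P
  ∈⟦⟧⁻ = toWitness

  stable : {P : Set ℓ} → ¬ ¬ P → P
  stable = decidable-stable em

  ⊆-antisym : {A : Set ℓ} {S S′ : Subset A} → S ⊆ S′ → S′ ⊆ S → S ≡ S′
  ⊆-antisym S⊆S′ S′⊆S = ext λ a → T-injective (S⊆S′ a) (S′⊆S a)

  module _ {A : Set ℓ} where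

    ⋃ : Subset (Subset A) → Subset A
    ⋃ Q = ⟦ (λ a → Σ[ S ∈ Subset A ] S ∈ Q × a ∈ S) ⟧

    ⊆⋃ : ∀ {Q S} → S ∈ Q → S ⊆ ⋃ Q
    ⊆⋃ S∈Q a a∈S = ∈⟦⟧⁺ (_ , S∈Q , a∈S)

    ⋃⊆ : ∀ {Q S} → (∀ S′ → S′ ∈ Q → S′ ⊆ S) → ⋃ Q ⊆ S
    ⋃⊆ below a a∈⋃ = let (S , S∈Q , a∈S) = ∈⟦⟧⁻ a∈⋃ in below S S∈Q a a∈S

    -- The empty set enters as the `union` of the empty family.
    data Tower (f : Subset A → Subset A) : Subset A → Set ℓ where
      step  : ∀ {S} → Tower f S → Tower f (f S)
      union : ∀ Q → (∀ S → S ∈ Q → Tower f S) → Tower f (⋃ Q)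

    module _ {f : Subset A → Subset A} (inflationary : ∀ S → S ⊆ f S) where

      -- The extreme points of the Bourbaki-Witt argument: a step of `f` from strictly below `S`
      -- cannot jump past `S`.
      Extreme : Subset A → Set ℓ
      Extreme S = ∀ S′ → Tower f S′ → S′ ⊆ S → S′ ≢ S → f S′ ⊆ S

      -- Induction on the tower of `S′`. A step from strictly below `S` stays below by extremality,
      -- a step from `S` lands on `f S`, and a union lies below `S` unless some member already
      -- contains `f S`.
      extreme⇒dichotomy : ∀ {S} → Extreme S → ∀ {S′} → Tower f S′ → S′ ⊆ S ⊎ f S ⊆ S′
      extreme⇒dichotomy {S} ext-S (step {S′} t) with extreme⇒dichotomy ext-S t
      ... | inj₂ fS⊆S′ = inj₂ λ a → inflationary S′ a ∘ fS⊆S′ a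
      ... | inj₁ S′⊆S with em {S′ ≡ S}
      ...   | yes refl = inj₂ λ _ a∈ → a∈
      ...   | no S′≢S  = inj₁ (ext-S S′ t S′⊆S S′≢S)
      extreme⇒dichotomy {S} ext-S (union Q towers)
        with em {Σ[ S′ ∈ Subset A ] S′ ∈ Q × f S ⊆ S′}
      ... | yes (S′ , S′∈Q , fS⊆S′) = inj₂ λ a → ⊆⋃ S′∈Q a ∘ fS⊆S′ a
      ... | no none = inj₁ (⋃⊆ below)
        where
        below : ∀ S′ → S′ ∈ Q → S′ ⊆ S
        below S′ S′∈Q with extreme⇒dichotomy ext-S (towers S′ S′∈Q)
        ... | inj₁ S′⊆S  = S′⊆S
        ... | inj₂ fS⊆S′ = contradiction (S′ , S′∈Q , fS⊆S′) none

      -- Induction on the tower of `S`. In the union case `S′` fits inside some member of `Q`, since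
      -- otherwise every member, and so the union, would lie inside `S′`.
      tower⇒extreme : ∀ {S} → Tower f S → Extreme S
      tower⇒extreme (step {S} t) S′ t′ S′⊆fS S′≢fS
        with extreme⇒dichotomy (tower⇒extreme t) t′
      ... | inj₂ fS⊆S′ = contradiction (⊆-antisym S′⊆fS fS⊆S′) S′≢fS
      ... | inj₁ S′⊆S with em {S′ ≡ S}
      ...   | yes refl = λ _ a∈ → a∈
      ...   | no S′≢S  = λ a → inflationary S a ∘ tower⇒extreme t S′ t′ S′⊆S S′≢S a
      tower⇒extreme (union Q towers) S′ t′ S′⊆⋃ S′≢⋃
        with em {Σ[ S ∈ Subset A ] S ∈ Q × S′ ⊆ S}
      ... | no none = contradiction (⊆-antisym S′⊆⋃ (⋃⊆ below)) S′≢⋃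
        where
        below : ∀ S → S ∈ Q → S ⊆ S′
        below S S∈Q with extreme⇒dichotomy (tower⇒extreme (towers S S∈Q)) t′
        ... | inj₁ S′⊆S  = contradiction (S , S∈Q , S′⊆S) none
        ... | inj₂ fS⊆S′ = λ a → fS⊆S′ a ∘ inflationary S a
      ... | yes (S , S∈Q , S′⊆S) with em {S′ ≡ S}
      ...   | no S′≢S  = λ a → ⊆⋃ S∈Q a ∘ tower⇒extreme (towers S S∈Q) S′ t′ S′⊆S S′≢S a
      ...   | yes refl
              -- Here `S′` is the member `S` itself, not strictly below it, so it is compared with
              -- the whole union instead.
              with extreme⇒dichotomy (tower⇒extreme (towers S S∈Q)) (union Q towers)
      ...     | inj₁ ⋃⊆S′  = contradiction (⊆-antisym S′⊆⋃ ⋃⊆S′) S′≢⋃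
      ...     | inj₂ fS′⊆⋃ = fS′⊆⋃

      tower-trichotomy : ∀ {S S′} → Tower f S → Tower f S′ → S ≡ S′ ⊎ f S ⊆ S′ ⊎ f S′ ⊆ S
      tower-trichotomy {S} {S′} t t′ with em {S ≡ S′}
      ... | yes S≡S′ = inj₁ S≡S′
      ... | no  S≢S′ with extreme⇒dichotomy (tower⇒extreme t) t′
      ...   | inj₂ fS⊆S′ = inj₂ (inj₁ fS⊆S′)
      ...   | inj₁ S′⊆S  = inj₂ (inj₂ (tower⇒extreme t S′ t′ S′⊆S (S≢S′ ∘ sym)))

-- The lexicographic order on subsets

    -- Excluded middle is untruncated, so it acts as a choice function.
    next : Subset A → Maybe A
    next S with em {∃[ a ] a ∉ S}
    ... | yes (a , _) = just a
    ... | no  _       = nothing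

    next-defined : ∀ {S a} → a ∉ S → ∃[ b ] next S ≡ just b × b ∉ S
    next-defined {S} a∉S with em {∃[ a ] a ∉ S}
    ... | yes (b , b∉S) = b , refl , b∉S
    ... | no  none      = contradiction (_ , a∉S) none

    adjoin : Subset A → Subset A
    adjoin S = ⟦ (λ a → a ∈ S ⊎ next S ≡ just a) ⟧

    adjoin-inflationary : ∀ S → S ⊆ adjoin S
    adjoin-inflationary S a a∈S = ∈⟦⟧⁺ (inj₁ a∈S)

    next∈adjoin : ∀ {S a} → next S ≡ just a → a ∈ adjoin S
    next∈adjoin eq = ∈⟦⟧⁺ (inj₂ eq)

    infix 4 _<_

    -- Tower sets act as initial segments of a well-ordering, with `next S` the first point beyond
    -- `S`. Thus `a` is the first difference of `U` and `V`, and the set containing it is the larger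
    -- one.
    _<_ : Rel (Subset A) ℓ
    U < V = Σ[ S ∈ Subset A ] Tower adjoin S × Agree U V S ×
            (∃[ a ] next S ≡ just a × a ∉ U × a ∈ V)

    <-irrefl : ∀ {U} → ¬ (U < U)
    <-irrefl (_ , _ , _ , _ , _ , a∉U , a∈U) = a∉U a∈U

    -- The earlier of the two first differences decides; if they coincided, the same point would be
    -- both in and outside `V`.
    <-trans : ∀ {U V W} → U < V → V < W → U < W
    <-trans (S , t , agree , a , eq , a∉U , a∈V) (S′ , t′ , agree′ , b , eq′ , b∉V , b∈W)
      with tower-trichotomy adjoin-inflationary t t′
    ... | inj₁ refl =
      contradiction (subst _ (just-injective (trans (sym eq) eq′)) a∈V) b∉V
    ... | inj₂ (inj₁ fS⊆S′) =
      S , t ,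
      (λ x x∈S → trans (agree x x∈S) (agree′ x (fS⊆S′ x (adjoin-inflationary S x x∈S)))) ,
      a , eq , a∉U , subst T (agree′ a (fS⊆S′ a (next∈adjoin eq))) a∈V
    ... | inj₂ (inj₂ fS′⊆S) =
      S′ , t′ ,
      (λ x x∈S′ → trans (agree x (fS′⊆S x (adjoin-inflationary S′ x x∈S′))) (agree′ x x∈S′)) ,
      b , eq′ , b∉V ∘ subst T (agree b (fS′⊆S b (next∈adjoin eq′))) , b∈W

    -- The first difference of U and V is the element adjoined to the largest tower set
    -- on which they agree.
    <-connex : ∀ {U V} → U ≢ V → U < V ⊎ V < U
    <-connex {U} {V} U≢V = compare (T? (U b)) (T? (V b))
      where
      Q : Subset (Subset A)
      Q = ⟦ (λ S → Tower adjoin S × Agree U V S) ⟧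

      tower : Tower adjoin (⋃ Q)
      tower = union Q λ _ → proj₁ ∘ ∈⟦⟧⁻

      agree : Agree U V (⋃ Q)
      agree a a∈⋃ =
        let (S , S∈Q , a∈S) = ∈⟦⟧⁻ a∈⋃
        in proj₂ (∈⟦⟧⁻ S∈Q) a a∈S

      outside : ∃[ a ] a ∉ ⋃ Q
      outside = stable λ none → U≢V (ext λ a →
        agree a (decidable-stable (T? _) λ a∉⋃ → none (a , a∉⋃)))

      new : ∃[ b ] next (⋃ Q) ≡ just b × b ∉ ⋃ Q
      new = next-defined (proj₂ outside)

      b : A
      b = proj₁ new

      next≡b : next (⋃ Q) ≡ just b
      next≡b = proj₁ (proj₂ new)

      -- Agreement at `b` would make `adjoin (⋃ Q)` a member of `Q`, forcing `b` into `⋃ Q`.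
      Ub≢Vb : U b ≢ V b
      Ub≢Vb Ub≡Vb = proj₂ (proj₂ new) (⊆⋃ (∈⟦⟧⁺ (step tower , agree⁺)) b (next∈adjoin next≡b))
        where
        agree⁺ : Agree U V (adjoin (⋃ Q))
        agree⁺ a a∈ with ∈⟦⟧⁻ a∈
        ... | inj₁ a∈⋃ = agree a a∈⋃
        ... | inj₂ eq with just-injective (trans (sym next≡b) eq)
        ...   | refl = Ub≡Vb

      compare : Dec (b ∈ U) → Dec (b ∈ V) → U < V ⊎ V < U
      compare (yes b∈U) (yes b∈V) =
        contradiction (T-injective (const b∈V) (const b∈U)) Ub≢Vb
      compare (yes b∈U) (no b∉V) =
        inj₂ (⋃ Q , tower , (λ a → sym ∘ agree a) , b , next≡b , b∉V , b∈U)
      compare (no b∉U) (yes b∈V) = inj₁ (⋃ Q , tower , agree , b , next≡b , b∉U , b∈V)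
      compare (no b∉U) (no b∉V) =
        contradiction (T-injective (⊥-elim ∘ b∉U) (⊥-elim ∘ b∉V)) Ub≢Vb

  -- Existence of linear extensions

  szpilrajn : {A : Set ℓ} {γ : Rel A ℓ} → IsPartialOrder _≡_ γ →
              Σ[ α ∈ Rel A ℓ ] IsLinearExtension γ α
  szpilrajn {A} {γ} po = _≤_ , linear , extends
    where
    module γ = IsPartialOrder po

    ↓ : A → Subset A
    ↓ x = ⟦ (λ z → γ z x) ⟧

    ↓-mono : ∀ {x y} → γ x y → ↓ x ⊆ ↓ y
    ↓-mono γxy z z∈ = ∈⟦⟧⁺ (γ.trans (∈⟦⟧⁻ z∈) γxy)

    ↓-reflects : ∀ {x y} → ↓ x ≡ ↓ y → γ x y
    ↓-reflects {x} eq = ∈⟦⟧⁻ (subst (x ∈_) eq (∈⟦⟧⁺ γ.refl))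

    ↓-injective : ∀ {x y} → ↓ x ≡ ↓ y → x ≡ y
    ↓-injective eq = γ.antisym (↓-reflects eq) (↓-reflects (sym eq))

    _≤_ : Rel A ℓ
    x ≤ y = x ≡ y ⊎ ↓ x < ↓ y

    ≤-trans : ∀ {x y z} → x ≤ y → y ≤ z → x ≤ z
    ≤-trans (inj₁ refl) y≤z         = y≤z
    ≤-trans (inj₂ x<y)  (inj₁ refl) = inj₂ x<y
    ≤-trans (inj₂ x<y)  (inj₂ y<z)  = inj₂ (<-trans x<y y<z)

    ≤-antisym : ∀ {x y} → x ≤ y → y ≤ x → x ≡ y
    ≤-antisym (inj₁ x≡y) _           = x≡y
    ≤-antisym (inj₂ _)   (inj₁ y≡x)  = sym y≡x
    ≤-antisym (inj₂ x<y) (inj₂ y<x)  = contradiction (<-trans x<y y<x) <-irrefl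

    ≤-total : ∀ x y → x ≤ y ⊎ y ≤ x
    ≤-total x y with em {x ≡ y}
    ... | yes x≡y = inj₁ (inj₁ x≡y)
    ... | no  x≢y with <-connex (x≢y ∘ ↓-injective)
    ...   | inj₁ x<y = inj₁ (inj₂ x<y)
    ...   | inj₂ y<x = inj₂ (inj₂ y<x)

    linear : IsLinearOrder _≤_
    linear = record
      { isPartialOrder = record
        { isPreorder = record
          { isEquivalence = isEquivalence ; reflexive = inj₁ ; trans = ≤-trans }
        ; antisym = ≤-antisym
        }
      ; total = ≤-total
      }

    extends : γ ⇒ _≤_
    extends {x} {y} γxy with ≤-total x y
    ... | inj₁ x≤y         = x≤y
    ... | inj₂ (inj₁ y≡x)  = inj₁ (sym y≡x)
    ... | inj₂ (inj₂ (_ , _ , _ , a , _ , a∉↓y , a∈↓x)) =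
      contradiction (↓-mono γxy a a∈↓x) a∉↓y

-- Refining half-spaces to linear extensions

  module _ {A : Set ℓ} where

    -- The condition `α y x → L x y` has force only inside a full block, where `L` breaks the tie;
    -- `M` orders the antichain blocks.
    refine : (α L M : Rel A ℓ) → Rel A ℓ
    refine α L M x y = (α x y × (α y x → L x y)) ⊎ (¬ α x y × ¬ α y x × M x y)

    -- Transitivity rests on the complement `β`: pairs outside `α` lie in `β`, and when two of them
    -- compose to a pair in `α`, the meet condition identifies its ends.
    refine-linear : {α L M : Rel A ℓ} → IsHalfSpace α → IsLinearOrder L → IsLinearOrder M →
                    IsLinearOrder (refine α L M)
    refine-linear {α} {L} {M} (qα , β , qβ , cover , meet) linL linM = record
      { isPartialOrder = record
        { isPreorder = record
          { isEquivalence = isEquivalence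
          ; reflexive     = λ { refl → R-refl }
          ; trans         = R-trans
          }
        ; antisym = R-antisym
        }
      ; total = R-total
      }
      where
      module α = IsPreorder qα
      module β = IsPreorder qβ
      module L = IsTotalOrder linL
      module M = IsTotalOrder linM

      R : Rel A ℓ
      R = refine α L M

      ¬α⇒β : ∀ {x y} → ¬ α x y → β x y
      ¬α⇒β {x} {y} ¬αxy with cover x y
      ... | inj₁ αxy = contradiction αxy ¬αxy
      ... | inj₂ βxy = βxy

      R-refl : ∀ {x} → R x x
      R-refl = inj₁ (α.refl , λ _ → L.refl)

      R-trans : ∀ {x y z} → R x y → R y z → R x z
      R-trans (inj₁ (αxy , Lxy)) (inj₁ (αyz , Lyz)) =
        inj₁ (α.trans αxy αyz ,
              λ αzx → L.trans (Lxy (α.trans αyz αzx)) (Lyz (α.trans αzx αxy)))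
      R-trans {x} {y} {z} (inj₁ (αxy , Lxy)) Ryz@(inj₂ (¬αyz , ¬αzy , _)) with em {α x z}
      ... | yes αxz = inj₁ (αxz , λ αzx → contradiction (α.trans αzx αxy) ¬αzy)
      ... | no ¬αxz = subst (λ w → R w z) (sym x≡y) Ryz
        where
        x≡y : x ≡ y
        x≡y = proj₁ meet (αxy , β.trans (¬α⇒β ¬αxz) (¬α⇒β ¬αzy))
      R-trans {x} {y} {z} Rxy@(inj₂ (¬αxy , ¬αyx , _)) (inj₁ (αyz , Lyz)) with em {α x z}
      ... | yes αxz = inj₁ (αxz , λ αzx → contradiction (α.trans αyz αzx) ¬αyx)
      ... | no ¬αxz = subst (R x) y≡z Rxy
        where
        y≡z : y ≡ z
        y≡z = proj₁ meet (αyz , β.trans (¬α⇒β ¬αyx) (¬α⇒β ¬αxz))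
      R-trans {x} {y} {z} (inj₂ (¬αxy , ¬αyx , Mxy)) (inj₂ (¬αyz , ¬αzy , Myz))
        with em {α x z} | em {α z x}
      ... | yes αxz | _ =
        subst (R x) (proj₁ meet (αxz , β.trans (¬α⇒β ¬αxy) (¬α⇒β ¬αyz))) R-refl
      ... | no _ | yes αzx =
        subst (R x) (sym (proj₁ meet (αzx , β.trans (¬α⇒β ¬αzy) (¬α⇒β ¬αyx)))) R-refl
      ... | no ¬αxz | no ¬αzx = inj₂ (¬αxz , ¬αzx , M.trans Mxy Myz)

      R-antisym : ∀ {x y} → R x y → R y x → x ≡ y
      R-antisym (inj₁ (αxy , Lxy)) (inj₁ (αyx , Lyx)) = L.antisym (Lxy αyx) (Lyx αxy)
      R-antisym (inj₁ (αxy , _)) (inj₂ (_ , ¬αxy , _)) = contradiction αxy ¬αxy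
      R-antisym (inj₂ (_ , ¬αyx , _)) (inj₁ (αyx , _)) = contradiction αyx ¬αyx
      R-antisym (inj₂ (_ , _ , Mxy)) (inj₂ (_ , _ , Myx)) = M.antisym Mxy Myx

      R-total : ∀ x y → R x y ⊎ R y x
      R-total x y with em {α x y} | em {α y x}
      ... | yes αxy | no ¬αyx = inj₁ (inj₁ (αxy , λ αyx → contradiction αyx ¬αyx))
      ... | no ¬αxy | yes αyx = inj₂ (inj₁ (αyx , λ αxy → contradiction αxy ¬αxy))
      ... | yes αxy | yes αyx with L.total x y
      ...   | inj₁ Lxy = inj₁ (inj₁ (αxy , const Lxy))
      ...   | inj₂ Lyx = inj₂ (inj₁ (αyx , const Lyx))
      R-total x y | no ¬αxy | no ¬αyx with M.total x y
      ...   | inj₁ Mxy = inj₁ (inj₂ (¬αxy , ¬αyx , Mxy))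
      ...   | inj₂ Myx = inj₂ (inj₂ (¬αyx , ¬αxy , Myx))

    halfSpaces⇒linearExtensions :
      {γ : Rel A ℓ} → IsPartialOrder _≡_ γ →
      {I : Set ℓ} {i₀ i₁ : I} → i₀ ≢ i₁ →
      (α : I → Rel A ℓ) → (∀ i → IsHalfSpace (α i)) → (λ x y → ∀ i → α i x y) ⇔ γ →
      Σ[ ρ ∈ (I → Rel A ℓ) ]
        (∀ i → IsLinearExtension γ (ρ i)) × (λ x y → ∀ i → ρ i x y) ⇔ γ
    halfSpaces⇒linearExtensions {γ} po {I} {i₀} {i₁} i₀≢i₁ α hs (⋂⇒γ , γ⇒⋂) =
      ρ , (λ i → ρ-linear i , ρ-extends i) ,
      (λ ρxy → ⋂⇒γ (⋂ρ⇒⋂α ρxy)) , λ γxy i → ρ-extends i γxy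
      where
      L : Rel A ℓ
      L = proj₁ (szpilrajn po)

      L-linear : IsLinearOrder L
      L-linear = proj₁ (proj₂ (szpilrajn po))

      module L = IsTotalOrder L-linear

      -- `ρ₁` is auxiliary: the antichain blocks of `ρ i₁` are ordered by `flip ρ₀` instead. `ρ₀` is
      -- `ρ i₀` once `i₀ ≡ i₀` is decided.
      ρ₁ ρ₀ : Rel A ℓ
      ρ₁ = refine (α i₁) L L
      ρ₀ = refine (α i₀) L (flip ρ₁)

      tieBreak : ∀ {i} → Dec (i ≡ i₀) → Rel A ℓ
      tieBreak (yes _) = flip ρ₁
      tieBreak (no  _) = flip ρ₀

      ρ : I → Rel A ℓ
      ρ i = refine (α i) L (tieBreak (em {i ≡ i₀}))

      ρ₁-linear : IsLinearOrder ρ₁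
      ρ₁-linear = refine-linear (hs i₁) L-linear L-linear

      ρ₀-linear : IsLinearOrder ρ₀
      ρ₀-linear = refine-linear (hs i₀) L-linear (flip-linear ρ₁-linear)

      tieBreak-linear : ∀ {i} (d : Dec (i ≡ i₀)) → IsLinearOrder (tieBreak d)
      tieBreak-linear (yes _) = flip-linear ρ₁-linear
      tieBreak-linear (no  _) = flip-linear ρ₀-linear

      ρ-linear : ∀ i → IsLinearOrder (ρ i)
      ρ-linear i = refine-linear (hs i) L-linear (tieBreak-linear em)

      ρ-extends : ∀ i → γ ⇒ ρ i
      ρ-extends i γxy = inj₁ (γ⇒⋂ γxy i , λ _ → proj₂ (proj₂ (szpilrajn po)) γxy)

      ≡⇒α : ∀ {i x y} → x ≡ y → α i x y
      ≡⇒α {i} = IsPreorder.reflexive (proj₁ (hs i))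

      ρi₀⇒ρ₀ : ∀ {x y} → ρ i₀ x y → ρ₀ x y
      ρi₀⇒ρ₀ with em {i₀ ≡ i₀}
      ... | yes _  = λ r → r
      ... | no neq = contradiction refl neq

      -- On a pair incomparable in `α i`, `ρ i` reverses `ρ₀`, so antisymmetry of `ρ₀` leaves only
      -- `x ≡ y`.
      ρ⇒α : ∀ {i x y} → i ≢ i₀ → ρ i₀ x y → ρ i x y → α i x y
      ρ⇒α _ _ (inj₁ (αxy , _)) = αxy
      ρ⇒α {i} i≢i₀ ρi₀xy (inj₂ (_ , _ , tie)) with em {i ≡ i₀}
      ... | yes i≡i₀ = contradiction i≡i₀ i≢i₀
      ... | no  _    = ≡⇒α (IsTotalOrder.antisym ρ₀-linear (ρi₀⇒ρ₀ ρi₀xy) tie)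

      -- A pair incomparable in `α i₀` satisfies `ρ₁ y x`. With `α i₁ x y` this puts it in a full
      -- block of `α i₁`, where `ρ₁` and `ρ i₁` both follow `L`, so `L` holds both ways.
      ρ₀⇒α : ∀ {x y} → ρ₀ x y → α i₁ x y → ρ i₁ x y → α i₀ x y
      ρ₀⇒α (inj₁ (αxy , _)) _ _ = αxy
      ρ₀⇒α (inj₂ (_ , _ , inj₂ (_ , ¬αxy , _))) αxy _ = contradiction αxy ¬αxy
      ρ₀⇒α (inj₂ (_ , _ , inj₁ _)) αxy (inj₂ (¬αxy , _)) = contradiction αxy ¬αxy
      ρ₀⇒α (inj₂ (_ , _ , inj₁ (αyx , Lyx))) αxy (inj₁ (_ , Lxy)) =
        ≡⇒α (L.antisym (Lxy αyx) (Lyx αxy))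

      ⋂ρ⇒⋂α : ∀ {x y} → (∀ i → ρ i x y) → ∀ i → α i x y
      ⋂ρ⇒⋂α ρxy i with em {i ≡ i₀}
      ... | no i≢i₀  = ρ⇒α i≢i₀ (ρxy i₀) (ρxy i)
      ... | yes refl =
        ρ₀⇒α (ρi₀⇒ρ₀ (ρxy i₀)) (ρ⇒α (i₀≢i₁ ∘ sym) (ρxy i₀) (ρxy i₁)) (ρxy i₁)

-- Removing repetitions from a realizer

  module _ {X : Set ℓ} (J : X → Set ℓ) (f : X → X) where

    -- Forward orbits of the points outside `J`. The bijection `h` shifts them by `f` and fixes all
    -- other points, which lie in `J` already.
    data Orbit : X → Set ℓ where
      start : ∀ {x} → ¬ J x → Orbit x
      advance : ∀ {x} → Orbit x → Orbit (f x)

    cantor-schröder-bernstein :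
      Injective _≡_ _≡_ f → (∀ x → J (f x)) →
      Σ[ h ∈ (X → X) ] Injective _≡_ _≡_ h × (∀ x → J (h x)) × (∀ {z} → J z → ∃[ x ] h x ≡ z)
    cantor-schröder-bernstein f-injective f∈J = h , h-injective , h∈J , h-onto
      where
      h : X → X
      h x with em {Orbit x}
      ... | yes _ = f x
      ... | no  _ = x

      h-injective : Injective _≡_ _≡_ h
      h-injective {x} {y} eq with em {Orbit x} | em {Orbit y}
      ... | yes _ | yes _ = f-injective eq
      ... | yes o | no ¬o = contradiction (subst Orbit eq (advance o)) ¬o
      ... | no ¬o | yes o = contradiction (subst Orbit (sym eq) (advance o)) ¬o
      ... | no _  | no _  = eq

      h∈J : ∀ x → J (h x)
      h∈J x with em {Orbit x}
      ... | yes _ = f∈J x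
      ... | no ¬o = stable (¬o ∘ start)

      h-onto : ∀ {z} → J z → ∃[ x ] h x ≡ z
      h-onto {z} z∈J with em {Orbit z}
      ... | yes (start z∉J) = contradiction z∈J z∉J
      ... | yes (advance {x} o) = x , hx≡fx
        where
        hx≡fx : h x ≡ f x
        hx≡fx with em {Orbit x}
        ... | yes _ = refl
        ... | no ¬o = contradiction o ¬o
      ... | no ¬o = z , hz≡z
        where
        hz≡z : h z ≡ z
        hz≡z with em {Orbit z}
        ... | yes o = contradiction o ¬o
        ... | no  _ = refl

  -- A representative depends only on the class as a Bool-valued set, hence by
  -- extensionality not on the element it is chosen for.
  module _ {X : Set ℓ} (_≈_ : Rel X ℓ) (≈-refl : ∀ {x} → x ≈ x)
           (≈-sym : ∀ {x y} → x ≈ y → y ≈ x) (≈-trans : ∀ {x y z} → x ≈ y → y ≈ z → x ≈ z) where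

    representatives : Σ[ r ∈ (X → X) ] (∀ x → x ≈ r x) × (∀ {x y} → x ≈ y → r x ≡ r y)
    representatives = r , r-≈ , r-cong
      where
      class : X → Subset X
      class x = ⟦ x ≈_ ⟧

      class-cong : ∀ {x y} → x ≈ y → class x ≡ class y
      class-cong x≈y = ⊆-antisym
        (λ z z∈ → ∈⟦⟧⁺ (≈-trans (≈-sym x≈y) (∈⟦⟧⁻ z∈)))
        (λ z z∈ → ∈⟦⟧⁺ (≈-trans x≈y (∈⟦⟧⁻ z∈)))

      choose : (S : Subset X) → ∃[ x ] x ∈ S → ∃[ x ] x ∈ S
      choose S inhabited with em {∃[ x ] x ∈ S}
      ... | yes chosen = chosen
      ... | no  empty  = contradiction inhabited empty

      -- The value comes from `em` applied to `S`; the given element only refutes the empty case.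
      choose-irrelevant : ∀ S (u v : ∃[ x ] x ∈ S) → choose S u ≡ choose S v
      choose-irrelevant S u v with em {∃[ x ] x ∈ S}
      ... | yes _     = refl
      ... | no  empty = contradiction u empty

      choose-cong : ∀ {S S′} → S ≡ S′ → (u : ∃[ x ] x ∈ S) (v : ∃[ x ] x ∈ S′) →
                    proj₁ (choose S u) ≡ proj₁ (choose S′ v)
      choose-cong refl u v = cong proj₁ (choose-irrelevant _ u v)

      inhabited : ∀ x → ∃[ y ] y ∈ class x
      inhabited x = x , ∈⟦⟧⁺ ≈-refl

      r : X → X
      r x = proj₁ (choose (class x) (inhabited x))

      r-≈ : ∀ x → x ≈ r x
      r-≈ x = ∈⟦⟧⁻ (proj₂ (choose (class x) (inhabited x)))

      r-cong : ∀ {x y} → x ≈ y → r x ≡ r y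
      r-cong x≈y = choose-cong (class-cong x≈y) (inhabited _) (inhabited _)

  -- The fixed points of `r` contain one index per class and so index a realizer without
  -- repetitions. Minimality injects `κ` into them, which yields a bijection `h` from `κ` onto them.
  removeRepetitions :
    {A : Set ℓ} {P : Rel A ℓ → Set p} {γ : Rel A ℓ} {κ : Set ℓ} →
    (∀ J → Realizer P γ J → κ ↣ J) →
    (ρ : κ → Rel A ℓ) → (∀ i → P (ρ i)) → (λ x y → ∀ i → ρ i x y) ⇔ γ →
    Realizer P γ κ
  removeRepetitions {P = P} {γ} {κ} minimal ρ member (⋂⇒γ , γ⇒⋂) = record
    { rel          = ρ ∘ h
    ; distinct     = λ ρh⇔ρh → h-injective
        (trans (sym (h∈J _)) (trans (r-cong ρh⇔ρh) (h∈J _)))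
    ; member       = member ∘ h
    ; intersection = (λ ρhxy → ⋂J⇒γ λ j j∈J →
                        let (i , hi≡j) = h-onto j∈J in subst (λ k → ρ k _ _) hi≡j (ρhxy i))
                   , (λ γxy → γ⇒⋂ γxy ∘ h)
    }
    where
    _≈_ : Rel κ ℓ
    i ≈ j = ρ i ⇔ ρ j

    reps : Σ[ r ∈ (κ → κ) ] (∀ i → i ≈ r i) × (∀ {i j} → i ≈ j → r i ≡ r j)
    reps = representatives _≈_ ((λ q → q) , (λ q → q)) (λ (f , g) → g , f)
      (λ (f , g) (f′ , g′) → (λ q → f′ (f q)) , (λ q → g (g′ q)))

    r : κ → κ
    r = proj₁ reps

    r-cong : ∀ {i j} → i ≈ j → r i ≡ r j
    r-cong = proj₂ (proj₂ reps)

    J : κ → Set ℓ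
    J i = r i ≡ i

    r∈J : ∀ i → J (r i)
    r∈J i = sym (r-cong (proj₁ (proj₂ reps) i))

    ⋂J⇒γ : ∀ {x y} → (∀ j → J j → ρ j x y) → γ x y
    ⋂J⇒γ ρxy = ⋂⇒γ λ i → proj₂ (proj₁ (proj₂ reps) i) (ρxy (r i) (r∈J i))

    -- Excluded middle decides equality on `κ`, so its identity proofs are unique; hence elements of
    -- `Σ[ i ∈ κ ] J i` are determined by their index.
    J-irrelevant : ∀ {i} (u v : J i) → u ≡ v
    J-irrelevant = Decidable⇒UIP.≡-irrelevant (λ _ _ → em)

    realizerJ : Realizer P γ (Σ[ i ∈ κ ] J i)
    realizerJ = record
      { rel          = ρ ∘ proj₁
      ; distinct     = λ { {_ , u} {_ , v} ρ⇔ρ →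
                           Σ-≡,≡→≡ (trans (sym u) (trans (r-cong ρ⇔ρ) v) , J-irrelevant _ _) }
      ; member       = member ∘ proj₁
      ; intersection = (λ ρxy → ⋂J⇒γ λ j j∈J → ρxy (j , j∈J)) , (λ γxy → γ⇒⋂ γxy ∘ proj₁)
      }

    module κ↣J = Injection (minimal _ realizerJ)

    bijection : Σ[ h ∈ (κ → κ) ]
      Injective _≡_ _≡_ h × (∀ i → J (h i)) × (∀ {j} → J j → ∃[ i ] h i ≡ j)
    bijection = cantor-schröder-bernstein J (proj₁ ∘ κ↣J.to)
      (λ eq → κ↣J.injective (Σ-≡,≡→≡ (eq , J-irrelevant _ _))) (proj₂ ∘ κ↣J.to)

    h : κ → κ
    h = proj₁ bijection

    h-injective : Injective _≡_ _≡_ h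
    h-injective = proj₁ (proj₂ bijection)

    h∈J : ∀ i → J (h i)
    h∈J = proj₁ (proj₂ (proj₂ bijection))

    h-onto : ∀ {j} → J j → ∃[ i ] h i ≡ j
    h-onto = proj₂ (proj₂ (proj₂ bijection))

-- Half-space dimension and order dimension

  module _ {A : Set ℓ} {γ : Rel A ℓ} (po : IsPartialOrder _≡_ γ) where

    -- Minimality carries over because a realizer by linear extensions is also one by half-spaces.
    hsdim≥2⇒dim≡hsdim : ∀ {κ} → hsdim γ ≡ᶜ κ → card {ℓ} 2 ↣ κ → dim γ ≡ᶜ κ
    hsdim≥2⇒dim≡hsdim {κ} (R , minimal) 2↣κ =
      let (ρ , ρ-ext , ⋂ρ⇔γ) = halfSpaces⇒linearExtensions po i₀≢i₁ rel member intersection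
      in removeRepetitions minimal′ ρ ρ-ext ⋂ρ⇔γ , minimal′
      where
      open Realizer R
      module 2↣κ = Injection 2↣κ

      i₀≢i₁ : 2↣κ.to (lift zero) ≢ 2↣κ.to (lift (fsuc zero))
      i₀≢i₁ eq with 2↣κ.injective eq
      ... | ()

      minimal′ : ∀ J → Realizer (IsLinearExtension γ) γ J → κ ↣ J
      minimal′ J = minimal J ∘ linearRealizer⇒halfSpaceRealizer

    module _ (hsdim≡1 : hsdim γ ≡ᶜ card 1) where

      open Realizer (proj₁ hsdim≡1)

      hsdim≡1⇒halfSpace : IsHalfSpace γ
      hsdim≡1⇒halfSpace = halfSpace-resp-⇔ {α = rel (lift zero)} {β = γ}
        ((λ αxy → proj₁ intersection λ { (lift zero) → αxy }) ,
         (λ γxy → proj₂ intersection γxy (lift zero)))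
        (member (lift zero))

      minimal : ∀ J → Realizer (IsLinearExtension γ) γ J → card 1 ↣ J
      minimal J = proj₂ hsdim≡1 J ∘ linearRealizer⇒halfSpaceRealizer

      linear⇒dim≡1 : IsLinearOrder γ → dim γ ≡ᶜ card 1
      linear⇒dim≡1 lin = realizer , minimal
        where
        realizer : Realizer (IsLinearExtension γ) γ (card 1)
        realizer = record
          { rel          = const γ
          ; distinct     = λ { {lift zero} {lift zero} _ → refl }
          ; member       = λ _ → lin , λ γxy → γxy
          ; intersection = (λ γxy → γxy (lift zero)) , λ γxy _ → γxy
          }

      nonlinear⇒dim≡2 : ¬ IsLinearOrder γ → dim γ ≡ᶜ card 2
      nonlinear⇒dim≡2 ¬lin = realizer , minimal₂
        where
        refinements : Σ[ ρ ∈ (card 2 → Rel A ℓ) ]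
          (∀ i → IsLinearExtension γ (ρ i)) × (λ x y → ∀ i → ρ i x y) ⇔ γ
        -- The half-space `γ` is repeated at two distinct indices; the two refinements order its
        -- antichain blocks oppositely.
        refinements = halfSpaces⇒linearExtensions po
          {i₀ = lift zero} {i₁ = lift (fsuc zero)} (λ ()) (const γ)
          (λ _ → hsdim≡1⇒halfSpace) ((λ γxy → γxy (lift zero)) , λ γxy _ → γxy)

        ρ : card 2 → Rel A ℓ
        ρ = proj₁ refinements

        ρ-ext : ∀ i → IsLinearExtension γ (ρ i)
        ρ-ext = proj₁ (proj₂ refinements)

        ⋂ρ⇔γ : (λ x y → ∀ i → ρ i x y) ⇔ γ
        ⋂ρ⇔γ = proj₂ (proj₂ refinements)

        ρ₀≢ρ₁ : ¬ (ρ (lift zero) ⇔ ρ (lift (fsuc zero)))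
        ρ₀≢ρ₁ (ρ₀⇒ρ₁ , _) = ¬lin (least-linear ρ ⋂ρ⇔γ (proj₁ (ρ-ext (lift zero)))
          λ { (lift zero) q → q ; (lift (fsuc zero)) q → ρ₀⇒ρ₁ q })

        realizer : Realizer (IsLinearExtension γ) γ (card 2)
        realizer = record
          { rel          = ρ
          ; distinct     = λ
            { {lift zero}        {lift zero}        _       → refl
            ; {lift (fsuc zero)} {lift (fsuc zero)} _       → refl
            ; {lift zero}        {lift (fsuc zero)} ρ₀⇔ρ₁   → ⊥-elim (ρ₀≢ρ₁ ρ₀⇔ρ₁)
            ; {lift (fsuc zero)} {lift zero}        (f , g) → ⊥-elim (ρ₀≢ρ₁ (g , f))
            }
          ; member       = ρ-ext
          ; intersection = ⋂ρ⇔γ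
          }

        -- One element of `J` comes from `minimal`. A second one gives the injection; without it the
        -- single member would be least, making `γ` linear.
        minimal₂ : ∀ J → Realizer (IsLinearExtension γ) γ J → card 2 ↣ J
        minimal₂ J S with em {∃[ k ] k ≢ Injection.to (minimal J S) (lift zero)}
        ... | yes (k , k≢j) = mk↣ {to = to} injective
          where
          to : card 2 → J
          to (lift zero)     = Injection.to (minimal J S) (lift zero)
          to (lift (fsuc _)) = k

          injective : Injective _≡_ _≡_ to
          injective {lift zero}        {lift zero}        _  = refl
          injective {lift zero}        {lift (fsuc _)}    eq = contradiction (sym eq) k≢j
          injective {lift (fsuc _)}    {lift zero}        eq = contradiction eq k≢j
          injective {lift (fsuc zero)} {lift (fsuc zero)} _  = refl
        ... | no none = contradiction
          (least-linear S.rel S.intersection (proj₁ (S.member _))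
            λ k → subst (λ i → S.rel i _ _) (sym (stable λ k≢j → none (k , k≢j))))
          ¬lin
          where module S = Realizer S

theorem2p16 : ∀ {ℓ : Level} →
    ExcludedMiddle (suc ℓ) → Extensionality (suc ℓ) (suc ℓ) →
    (A : Set ℓ) (γ : Rel A ℓ) → IsPartialOrder _≡_ γ →
    (hsdim γ ≡ᶜ card 1 →
    IsHalfSpace γ ×
    (IsLinearOrder γ → dim γ ≡ᶜ card 1) ×
    (¬ IsLinearOrder γ → dim γ ≡ᶜ card 2))
    ×
    (∀ (κ : Set ℓ) → hsdim γ ≡ᶜ κ → card {ℓ} 2 ↣ κ → dim γ ≡ᶜ κ)
theorem2p16 {ℓ} em ext A γ po =
  (λ hsdim≡1 → hsdim≡1⇒halfSpace po hsdim≡1 , linear⇒dim≡1 po hsdim≡1 , nonlinear⇒dim≡2 po hsdim≡1) ,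
  λ κ → hsdim≥2⇒dim≡hsdim po
  where open Classical (lower-em em) (lower-extensionality (suc ℓ) (suc ℓ) ext)
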